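{- Let $G=(V,E)$ be a directed acyclic graph, let $S_p$ be a path decomposition of $G$, and let $H$ and $H'$ be the associated path decomposition graph and reduced path decomposition graph. Then $H$ and $H'$ have the same reachability properties as $G$; that is, for all $u,v\in V$, there is a directed path from $u$ to $v$ in $G$ if and only if there is one in $H$, if and only if there is one in $H'$.
   Context: A path decomposition of a DAG $G=(V,E)$ is a set $S_p=\{P_1,\dots,P_k\}$ of vertex-disjoint directed paths of $G$ whose vertex sets partition $V$; its members are called decomposition paths (each is ordered along the path). The path decomposition graph associated with $S_p$ is $H=(V,A)$, where $e=(u,v)\in A$ if and only if $e\in E$ and either (a) $u,v$ are consecutive vertices of a path of $S_p$ ("path edge"), or (b) $u$ and $v$ belong to different paths of $S_p$ ("cross edge"). The graph $H'=(V,A')$ is obtained from $H$ by removing some cross edges as follows: for every vertex $v$, a cross edge $(u,v)\in A$ is removed if there exists an edge $(u',v)\in A$ such that $u'$ and $u$ are in the same decomposition path $P$ and $u$ precedes $u'$ in the order of $P$. -}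

module Defs where

open import Level using (0ℓ)
open import Data.Nat using (ℕ; suc)
open import Data.Fin using (Fin; suc; inject₁; _<_)
open import Data.Product using (_×_; ∃; ∃₂)
open import Data.Sum using (_⊎_)
open import Relation.Nullary using (¬_)
open import Relation.Binary using (Rel; Decidable)
open import Relation.Binary.PropositionalEquality using (_≡_; _≢_)
open import Relation.Binary.Construct.Closure.Transitive using (TransClosure)
open import Relation.Binary.Construct.Closure.ReflexiveTransitive using (Star)

-- Finite directed acyclic graphs.  A finite graph is given as explicit data,
-- so its adjacency relation is decidable.
record DAG : Set₁ where
  field
    order   : ℕ
    Edge    : Rel (Fin order) 0ℓ
    edge?   : Decidable Edge
    acyclic : ∀ v → ¬ TransClosure Edge v v

  Vertex : Set
  Vertex = Fin order

-- The length-0 path from a vertex to itself counts.  Vertices of a walk are not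
-- required to be distinct: in an acyclic graph, and in any subgraph of one,
-- they always are.
Reachable : ∀ {V : Set} → Rel V 0ℓ → Rel V 0ℓ
Reachable _⟶_ = Star _⟶_

module _ (G : DAG) where
  open DAG G

  -- A path has at least one vertex; distinctness of its vertices is again
  -- automatic by acyclicity.
  record DirectedPath : Set where
    field
      length : ℕ
      vertex : Fin (suc length) → Vertex
      edge   : ∀ (i : Fin length) → Edge (vertex (inject₁ i)) (vertex (suc i))

module _ {G : DAG} where
  open DAG G

  infix 4 _∈ₚ_

  _∈ₚ_ : Vertex → DirectedPath G → Set
  v ∈ₚ P = ∃ λ i → vertex i ≡ v
    where open DirectedPath P

  Consecutive : DirectedPath G → Rel Vertex 0ℓ
  Consecutive P u v = ∃ λ (i : Fin length) → vertex (inject₁ i) ≡ u × vertex (suc i) ≡ v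
    where open DirectedPath P

  Precedes : DirectedPath G → Rel Vertex 0ℓ
  Precedes P u v = ∃₂ λ i j → i < j × vertex i ≡ u × vertex j ≡ v
    where open DirectedPath P

record PathDecomposition (G : DAG) : Set where
  open DAG G
  field
    size     : ℕ
    path     : Fin size → DirectedPath G
    disjoint : ∀ {v i j} → v ∈ₚ path i → v ∈ₚ path j → i ≡ j
    covers   : ∀ v → ∃ λ i → v ∈ₚ path i

module _ {G : DAG} (S : PathDecomposition G) where
  open DAG G
  open PathDecomposition S

  ConsecutiveOnPath : Rel Vertex 0ℓ
  ConsecutiveOnPath u v = ∃ λ i → Consecutive (path i) u v

  OnDifferentPaths : Rel Vertex 0ℓ
  OnDifferentPaths u v = ∃₂ λ i j → i ≢ j × u ∈ₚ path i × v ∈ₚ path j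

  -- The edge set A of H.
  HEdge : Rel Vertex 0ℓ
  HEdge u v = Edge u v × (ConsecutiveOnPath u v ⊎ OnDifferentPaths u v)

  CrossEdge : Rel Vertex 0ℓ
  CrossEdge u v = HEdge u v × OnDifferentPaths u v

  -- All removals are judged against the edges of H itself, not against the
  -- edges that survive other removals.
  Removed : Rel Vertex 0ℓ
  Removed u v = CrossEdge u v × ∃₂ λ u′ i → HEdge u′ v × Precedes (path i) u u′

  -- The edge set A′ of H′.
  H′Edge : Rel Vertex 0ℓ
  H′Edge u v = HEdge u v × ¬ Removed u v

{-# OPTIONS --safe #-}
module Submission where

open import Defs
open import Level using (0ℓ)
open import Data.Nat using (suc; s<s⁻¹; z<s)
open import Data.Fin using (Fin; zero; suc; inject₁; _<_)
open import Data.Fin.Properties using (any?; _≟_; _<?_; <-cmp)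
open import Data.Fin.Induction using (spo-noetherian)
open import Data.Product using (_×_; _,_; proj₁; proj₂)
open import Data.Sum using (inj₁; inj₂)
open import Data.Empty using (⊥-elim)
open import Function.Base using (_∘_; flip)
open import Function.Bundles using (_⇔_; mk⇔)
open import Induction.WellFounded using (Acc; acc)
open import Relation.Nullary using (¬_; Dec; yes; no)
open import Relation.Nullary.Decidable using (_×-dec_; _⊎-dec_; ¬?)
open import Relation.Binary using (Rel; Transitive; Decidable; IsStrictPartialOrder; tri<; tri≈; tri>)
open import Relation.Binary.PropositionalEquality using (_≡_; refl; sym; trans; subst; isEquivalence; resp₂)
open import Relation.Binary.Construct.Closure.Transitive using (TransClosure; [_]; _∷_; _++_)
open import Relation.Binary.Construct.Closure.ReflexiveTransitive using (ε; _◅_; _◅◅_; map; _⋆)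

-- Edges only get lost on the way from G to H to H′, so it is enough to replace each lost edge by a
-- walk in the smaller graph. An edge of G between two vertices of one decomposition path must point
-- forward along it, since otherwise it would close a cycle; it is replaced by a segment of that
-- path, whose edges survive even in H′. A removed cross edge is replaced by a path segment from u
-- to u′ followed by an edge from u′ to v, which is replaced in turn if necessary. Since u′ lies
-- strictly beyond u in a finite acyclic graph, this stops.

-- Used twice along a decomposition path: with `TransClosure Edge`, to detect cycles and to measure
-- progress, and with reachability in H′, to build detours.
stepwise⇒monotone : ∀ {A : Set} (_∼_ : Rel A 0ℓ) → Transitive _∼_ →
  ∀ {n} (f : Fin (suc n) → A) → (∀ i → f (inject₁ i) ∼ f (suc i)) →
  ∀ {i j} → i < j → f i ∼ f j
stepwise⇒monotone _∼_ tr {suc n} f step {zero}  {suc zero}    _   = step zero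
stepwise⇒monotone _∼_ tr {suc n} f step {zero}  {suc (suc j)} _   =
  tr (step zero) (stepwise⇒monotone _∼_ tr (f ∘ suc) (step ∘ suc) {zero} {suc j} z<s)
stepwise⇒monotone _∼_ tr {suc n} f step {suc i} {suc j}       i<j =
  stepwise⇒monotone _∼_ tr (f ∘ suc) (step ∘ suc) (s<s⁻¹ i<j)

module _ (G : DAG) where
  open DAG G

  -- On a finite vertex set this order is Noetherian, which supports the induction for H′.
  edge⁺-isStrictPartialOrder : IsStrictPartialOrder _≡_ (TransClosure Edge)
  edge⁺-isStrictPartialOrder = record
    { isEquivalence = isEquivalence
    ; irrefl        = λ { {v} refl → acyclic v }
    ; trans         = _++_
    ; <-resp-≈      = resp₂ _
    }

module _ {G : DAG} where
  open DAG G

  precedes⇒edge⁺ : ∀ (P : DirectedPath G) {u v} → Precedes P u v → TransClosure Edge u v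
  precedes⇒edge⁺ P (i , j , i<j , refl , refl) =
    stepwise⇒monotone (TransClosure Edge) _++_ vertex ([_] ∘ edge) i<j
    where open DirectedPath P

  precedes? : ∀ (P : DirectedPath G) → Decidable (Precedes P)
  precedes? P u v = any? λ i → any? λ j → i <? j ×-dec vertex i ≟ u ×-dec vertex j ≟ v
    where open DirectedPath P

  consecutive? : ∀ (P : DirectedPath G) → Decidable (Consecutive P)
  consecutive? P u v = any? λ i → vertex (inject₁ i) ≟ u ×-dec vertex (suc i) ≟ v
    where open DirectedPath P

  ∈ₚ? : ∀ v (P : DirectedPath G) → Dec (v ∈ₚ P)
  ∈ₚ? v P = any? λ i → vertex i ≟ v
    where open DirectedPath P

module _ {G : DAG} (S : PathDecomposition G) where
  open DAG G
  open PathDecomposition S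

  onDifferentPaths? : Decidable (OnDifferentPaths S)
  onDifferentPaths? u v =
    any? λ i → any? λ j → ¬? (i ≟ j) ×-dec ∈ₚ? u (path i) ×-dec ∈ₚ? v (path j)

  hEdge? : Decidable (HEdge S)
  hEdge? u v =
    edge? u v ×-dec (any? (λ i → consecutive? (path i) u v) ⊎-dec onDifferentPaths? u v)

  -- `H′Edge` only negates `Removed`. Deciding it is what yields the witness u′ when an edge fails
  -- to survive.
  removed? : Decidable (Removed S)
  removed? u v =
    (hEdge? u v ×-dec onDifferentPaths? u v) ×-dec
    any? λ u′ → any? λ i → hEdge? u′ v ×-dec precedes? (path i) u u′

  samePath⇒¬onDifferentPaths : ∀ {u v} k → u ∈ₚ path k → v ∈ₚ path k → ¬ OnDifferentPaths S u v
  samePath⇒¬onDifferentPaths k u∈k v∈k (i , j , i≢j , u∈i , v∈j) =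
    i≢j (trans (disjoint u∈i u∈k) (disjoint v∈k v∈j))

  -- Only cross edges are ever removed, and disjointness of the paths keeps a path edge from being
  -- one.
  pathEdge⇒h′Edge : ∀ k i →
    H′Edge S (DirectedPath.vertex (path k) (inject₁ i)) (DirectedPath.vertex (path k) (suc i))
  pathEdge⇒h′Edge k i =
    (edge i , inj₁ (k , i , refl , refl)) ,
    λ ((_ , different) , _) →
      samePath⇒¬onDifferentPaths k (inject₁ i , refl) (suc i , refl) different
    where open DirectedPath (path k)

  precedes⇒h′Reachable : ∀ k {u v} → Precedes (path k) u v → Reachable (H′Edge S) u v
  precedes⇒h′Reachable k (i , j , i<j , refl , refl) =
    stepwise⇒monotone (Reachable (H′Edge S)) _◅◅_ vertex (λ i → pathEdge⇒h′Edge k i ◅ ε) i<j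
    where open DirectedPath (path k)

  edge⇒hReachable : ∀ {u v} → Edge u v → Reachable (HEdge S) u v
  edge⇒hReachable {u} {v} e with covers u | covers v
  ... | i , u∈i | j , v∈j with i ≟ j
  ... | no i≢j = (e , inj₂ (i , j , i≢j , u∈i , v∈j)) ◅ ε
  edge⇒hReachable {u} {v} e | i , a , a↦u | .i , b , b↦v | yes refl with <-cmp a b
  -- The path segment is a walk in H′; forgetting that its edges were not removed makes it a walk in
  -- H.
  ... | tri< a<b _ _  = map proj₁ (precedes⇒h′Reachable i (a , b , a<b , a↦u , b↦v))
  -- Equal positions would make the edge a loop.
  ... | tri≈ _ refl _ = ⊥-elim (acyclic v [ subst (λ w → Edge w v) (trans (sym a↦u) b↦v) e ])
  -- A backward edge closes a cycle with the segment from v to u.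
  ... | tri> _ _ b<a  = ⊥-elim (acyclic u (e ∷ precedes⇒edge⁺ (path i) (b , a , b<a , b↦v , a↦u)))

  -- A removed edge (u , v) is bypassed by following the path of u to a later
  -- u′ with (u′ , v) ∈ A; that edge may itself be removed, but u′ is strictly
  -- after u in the acyclic graph, so the detours terminate.
  hEdge⇒h′Reachable : ∀ {u v} → HEdge S u v → Reachable (H′Edge S) u v
  hEdge⇒h′Reachable {u} = go (spo-noetherian (edge⁺-isStrictPartialOrder G) u)
    where
    go : ∀ {u v} → Acc (flip (TransClosure Edge)) u → HEdge S u v → Reachable (H′Edge S) u v
    go {u} {v} (acc rs) h with removed? u v
    ... | no ¬removed = (h , ¬removed) ◅ ε
    ... | yes (_ , u′ , i , h′ , u≺u′) =
      precedes⇒h′Reachable i u≺u′ ◅◅ go (rs (precedes⇒edge⁺ (path i) u≺u′)) h′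

theorem2 : (G : DAG) (S : PathDecomposition G) (u v : DAG.Vertex G) →
    (Reachable (DAG.Edge G) u v ⇔ Reachable (HEdge S) u v) ×
    (Reachable (HEdge S) u v ⇔ Reachable (H′Edge S) u v)
theorem2 G S u v =
  mk⇔ (edge⇒hReachable S ⋆) (map proj₁) ,
  mk⇔ (hEdge⇒h′Reachable S ⋆) (map proj₁)
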